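{- Consider triples of integers $(n,\alpha,k)$ satisfying $n\geq 2\alpha$, $n\geq\alpha+k$, $\alpha\geq 2$, $k\geq 3$. Call such a triple a counterexample if the formula $$f(n,\alpha,k)=\begin{cases}\left\lceil \dfrac{nk}{2}\right\rceil,&n\leq k\alpha,\\[6pt] t(n,\alpha)+\left\lceil\dfrac{k\alpha}{2}\right\rceil,&n>k\alpha\end{cases}$$ fails for it. Then the minimum possible order $n$ of a counterexample is seven. More precisely, $f(7,3,4)=15$, while the formula predicts $14$.
   Context: All graphs are finite, simple, and undirected. A graph is $k$-connected if it has more than $k$ vertices and deleting any set of fewer than $k$ vertices leaves a connected graph. The independence number of a graph is the maximum cardinality of a set of pairwise nonadjacent vertices. For integers $n,\alpha,k$ for which the class of $k$-connected graphs of order $n$ and independence number (exactly) $\alpha$ is nonempty, $f(n,\alpha,k)$ denotes the minimum number of edges of a graph in this class. If $n=q\alpha+r$ with $0\leq r<\alpha$, then $t(n,\alpha)=r\binom{q+1}{2}+(\alpha-r)\binom{q}{2}$, the number of edges of the disjoint union of $\alpha$ cliques of total order $n$ whose orders differ by at most one. -}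

module Defs where

open import Data.Bool using (Bool; true; false; T; T?; if_then_else_)
open import Data.Fin using (Fin; _<_; _<?_)
open import Data.Fin.Subset using (Subset; _∈_; _∉_; ∣_∣)
open import Data.List using (List; length; filter; cartesianProduct; allFin)
open import Data.Nat as ℕ
  using (ℕ; NonZero; _+_; _*_; _∸_; _≤_; _≤ᵇ_; _/_; _%_; ⌈_/2⌉; z<s; >-nonZero)
open import Data.Nat.Combinatorics using (_C_)
open import Data.Nat.Properties using (<-trans)
open import Data.Product using (_×_; _,_; ∃)
open import Relation.Binary.Construct.Closure.ReflexiveTransitive using (Star)
open import Relation.Binary.PropositionalEquality using (_≡_)
open import Relation.Nullary using (¬_)
open import Relation.Nullary.Decidable using (_×-dec_)

-- Simple undirected graphs of order n, with vertex set Fin n.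
record Graph (n : ℕ) : Set where
  field
    adj     : Fin n → Fin n → Bool
    adj-sym : ∀ u v → adj u v ≡ adj v u
    adj-irr : ∀ u → adj u u ≡ false

  Adj : Fin n → Fin n → Set
  Adj u v = T (adj u v)

  -- Each edge {u , v} is listed once, as the pair with u < v.
  edges : List (Fin n × Fin n)
  edges = filter (λ (u , v) → (u <? v) ×-dec T? (adj u v))
                 (cartesianProduct (allFin n) (allFin n))

  edgeCount : ℕ
  edgeCount = length edges

  Independent : Subset n → Set
  Independent S = ∀ {u v} → u ∈ S → v ∈ S → ¬ Adj u v

  -- Adjacency in the graph obtained by deleting the vertices of S.
  AdjAvoiding : Subset n → Fin n → Fin n → Set
  AdjAvoiding S u v = u ∉ S × v ∉ S × Adj u v

  ConnectedAfterDeleting : Subset n → Set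
  ConnectedAfterDeleting S = ∀ {u v} → u ∉ S → v ∉ S → Star (AdjAvoiding S) u v

  Connected[_] : ℕ → Set
  Connected[ k ] = k ℕ.< n × (∀ S → ∣ S ∣ ℕ.< k → ConnectedAfterDeleting S)

  IndependenceNumber : ℕ → Set
  IndependenceNumber α =
    (∃ λ S → Independent S × ∣ S ∣ ≡ α) × (∀ S → Independent S → ∣ S ∣ ≤ α)

open Graph public using (edgeCount; Connected[_]; IndependenceNumber)

InClass : (n α k : ℕ) → Graph n → Set
InClass n α k G = Connected[_] G k × IndependenceNumber G α

-- f⟨ n , α , k ⟩≡ m says that the minimum f(n,α,k) exists and equals m. A
-- relation is used because f is defined only when the class is nonempty.
f⟨_,_,_⟩≡_ : (n α k m : ℕ) → Set
f⟨ n , α , k ⟩≡ m =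
  (∃ λ G → InClass n α k G × edgeCount G ≡ m) ×
  (∀ G → InClass n α k G → m ≤ edgeCount G)

t : (n α : ℕ) .{{_ : NonZero α}} → ℕ
t n α = r * ((q + 1) C 2) + (α ∸ r) * (q C 2)
  where
  q = n / α
  r = n % α

formula : (n α k : ℕ) .{{_ : NonZero α}} → ℕ
formula n α k =
  if n ≤ᵇ k * α
  then ⌈ n * k /2⌉
  else t n α + ⌈ k * α /2⌉

-- Under the four inequalities the class is nonempty (join a clique on n ∸ α
-- vertices with α isolated vertices), so `fails` says exactly that the value
-- f(n,α,k) differs from the formula.
record Counterexample (n α k : ℕ) : Set where
  field
    2α≤n  : 2 * α ≤ n
    α+k≤n : α + k ≤ n
    2≤α   : 2 ≤ α
    3≤k   : 3 ≤ k

  instance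
    α-nonZero : NonZero α
    α-nonZero = >-nonZero (<-trans z<s 2≤α)

  field
    fails : ¬ (f⟨ n , α , k ⟩≡ formula n α k)

{-# OPTIONS --safe #-}
-- Minimum degree at least k gives ⌈ n k / 2 ⌉ edges, and for the four admissible
-- triples of order at most six explicit graphs attain this. For (7 , 3 , 4), let S be
-- an independent set of order three: at least 3 · 4 edges leave S, and the graph on
-- the four remaining vertices is connected, so it has at least three edges. This
-- gives 15 edges, which the join of three isolated vertices with a path on four
-- vertices attains.
module Submission where

open import Defs
open import Algebra.Properties.Semiring.Sum as Sum using ()
open import Data.Bool using (Bool; true; false; T; T?; not; _∧_; _∨_)
open import Data.Bool.ListAction using (any)
open import Data.Bool.Properties as Boolₚ using (T-≡)
open import Data.Fin as Fin using (Fin; zero; suc; toℕ)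
open import Data.Fin.Properties as Finₚ using (all?; any?)
open import Data.Fin.Subset
  using (Subset; inside; outside; _∈_; _∉_; _⊆_; _∪_; ∁; ⊤; ⊥; ⁅_⁆; ∣_∣)
open import Data.Fin.Subset.Properties
  using ( _∈?_; anySubset?; p⊆q⇒∣p∣≤∣q∣; ∣⊥∣≡0; ∣⊤∣≡n; ∣⁅x⁆∣≡1; ∣∁p∣≡n∸∣p∣; ∈⊤
        ; x∈⁅x⁆; x∈⁅y⁆⇒x≡y; x∈p∪q⁻; x∈p∪q⁺; x∈∁p⇒x∉p; x∉p⇒x∈∁p )
open import Data.List as List using (List; []; _∷_; length; filter; cartesianProduct)
open import Data.List.Membership.Propositional using () renaming (_∈_ to _∈ₗ_)
open import Data.List.Properties using (filter-++; length-++; map-tabulate)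
open import Data.List.Relation.Unary.Any using (here; there)
open import Data.Nat
  using (ℕ; zero; suc; _+_; _*_; _∸_; _≤_; _<_; _≡ᵇ_; z≤n; s≤s; ⌈_/2⌉; _≤?_; _<?_; _≟_)
open import Data.Nat.Properties
open import Data.Nat.Tactic.RingSolver using (solve-∀)
open import Data.Product using (_×_; _,_; ∃; ∃₂; proj₂)
open import Data.Product.Properties using () renaming (≡-dec to ×-≡-dec)
open import Data.Sum using (_⊎_; inj₁; inj₂; [_,_]′)
open import Data.Vec using ([]; _∷_; lookup; tabulate)
open import Data.Vec.Properties using (lookup∘tabulate; lookup⇒[]=; []=⇒lookup)
open import Function using (_∘_; id; Equivalence)
open import Relation.Binary.Construct.Closure.ReflexiveTransitive using (Star; ε; _◅_)
open import Relation.Binary.Definitions using (tri<; tri≈; tri>)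
open import Relation.Binary.PropositionalEquality
  using (_≡_; refl; sym; trans; cong; cong₂; subst; subst₂; module ≡-Reasoning)
open import Relation.Nullary using (Dec; yes; no; does; ¬_; contradiction)
open import Relation.Nullary.Decidable
  using ( True; toWitness; from-yes; map′; dec-true; dec-false; decidable-stable
        ; ¬?; _×-dec_; _⊎-dec_; _→-dec_ )
open import Relation.Unary using (Decidable)

open Sum +-*-semiring using (sum; sum-syntax; sum-cong-≗; ∑-distrib-+; ∑-comm; *-distribˡ-sum; *-distribʳ-sum)

open Graph using (adj; adj-sym; adj-irr; Adj; Independent; AdjAvoiding; ConnectedAfterDeleting)

private
  variable
    n k : ℕ

-- Indicator functions, finite sums and cardinalities of subsets.

𝟙 : Bool → ℕ
𝟙 false = 0
𝟙 true  = 1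

χ : Subset n → Fin n → ℕ
χ S v = 𝟙 (lookup S v)

χ-∈ : {S : Subset n} {v : Fin n} → v ∈ S → χ S v ≡ 1
χ-∈ v∈S = cong 𝟙 ([]=⇒lookup v∈S)

χ-∉ : {S : Subset n} {v : Fin n} → v ∉ S → χ S v ≡ 0
χ-∉ {S = S} {v} v∉S with lookup S v in eq
... | false = refl
... | true  = contradiction (lookup⇒[]= v S eq) v∉S

∑-mono : {f g : Fin n → ℕ} → (∀ i → f i ≤ g i) → sum f ≤ sum g
∑-mono {zero}  f≤g = z≤n
∑-mono {suc n} f≤g = +-mono-≤ (f≤g zero) (∑-mono (f≤g ∘ suc))

term≤∑ : (f : Fin n → ℕ) (i : Fin n) → f i ≤ sum f
term≤∑ f zero    = m≤m+n _ _
term≤∑ f (suc i) = ≤-trans (term≤∑ (f ∘ suc) i) (m≤n+m _ _)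

∑-0 : {f : Fin n → ℕ} → (∀ i → f i ≡ 0) → sum f ≡ 0
∑-0 {zero}  f≡0 = refl
∑-0 {suc n} f≡0 = cong₂ _+_ (f≡0 zero) (∑-0 (f≡0 ∘ suc))

∣∣≡∑χ : (S : Subset n) → ∣ S ∣ ≡ sum (χ S)
∣∣≡∑χ []          = refl
∣∣≡∑χ (true  ∷ S) = cong suc (∣∣≡∑χ S)
∣∣≡∑χ (false ∷ S) = ∣∣≡∑χ S

∣∣<⇒∃∈∉ : (A W : Subset n) → ∣ A ∣ < ∣ W ∣ → ∃ λ v → v ∈ W × v ∉ A
∣∣<⇒∃∈∉ A W A<W with any? (λ v → (v ∈? W) ×-dec ¬? (v ∈? A))
... | yes p = p
... | no ¬p = contradiction (p⊆q⇒∣p∣≤∣q∣ W⊆A) (<⇒≱ A<W)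
  where
  W⊆A : W ⊆ A
  W⊆A {v} v∈W = decidable-stable (v ∈? A) λ v∉A → ¬p (v , v∈W , v∉A)

χ-∪-⁅⁆ : {A : Subset n} {y : Fin n} → y ∉ A → ∀ v → χ (A ∪ ⁅ y ⁆) v ≡ χ A v + χ ⁅ y ⁆ v
χ-∪-⁅⁆ {A = A} {y} y∉A v with v ∈? A | v ∈? ⁅ y ⁆
... | yes a | yes b = contradiction (subst (_∈ A) (x∈⁅y⁆⇒x≡y y b) a) y∉A
... | yes a | no  b = trans (χ-∈ {S = A ∪ ⁅ y ⁆} (x∈p∪q⁺ (inj₁ a))) (sym (cong₂ _+_ (χ-∈ a) (χ-∉ b)))
... | no  a | yes b = trans (χ-∈ {S = A ∪ ⁅ y ⁆} (x∈p∪q⁺ (inj₂ b))) (sym (cong₂ _+_ (χ-∉ a) (χ-∈ b)))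
... | no  a | no  b =
  trans (χ-∉ {S = A ∪ ⁅ y ⁆} ([ a , b ]′ ∘ x∈p∪q⁻ A ⁅ y ⁆)) (sym (cong₂ _+_ (χ-∉ a) (χ-∉ b)))

∣∪⁅⁆∣ : {A : Subset n} {y : Fin n} → y ∉ A → ∣ A ∪ ⁅ y ⁆ ∣ ≡ suc ∣ A ∣
∣∪⁅⁆∣ {n} {A} {y} y∉A = begin
  ∣ A ∪ ⁅ y ⁆ ∣                  ≡⟨ ∣∣≡∑χ (A ∪ ⁅ y ⁆) ⟩
  sum (χ (A ∪ ⁅ y ⁆))            ≡⟨ sum-cong-≗ (χ-∪-⁅⁆ y∉A) ⟩
  ∑[ v < n ] (χ A v + χ ⁅ y ⁆ v) ≡⟨ ∑-distrib-+ (χ A) (χ ⁅ y ⁆) ⟩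
  sum (χ A) + sum (χ ⁅ y ⁆)      ≡⟨ cong₂ _+_ (∣∣≡∑χ A) (∣∣≡∑χ ⁅ y ⁆) ⟨
  ∣ A ∣ + ∣ ⁅ y ⁆ ∣              ≡⟨ cong (∣ A ∣ +_) (∣⁅x⁆∣≡1 y) ⟩
  ∣ A ∣ + 1                      ≡⟨ +-comm ∣ A ∣ 1 ⟩
  suc ∣ A ∣                      ∎
  where open ≡-Reasoning

χ-∁ : (S : Subset n) → ∀ v → 1 ≡ χ S v + χ (∁ S) v
χ-∁ S v with v ∈? S
... | yes v∈S = sym (cong₂ _+_ (χ-∈ v∈S) (χ-∉ λ v∈∁S → x∈∁p⇒x∉p v∈∁S v∈S))
... | no  v∉S = sym (cong₂ _+_ (χ-∉ v∉S) (χ-∈ (x∉p⇒x∈∁p v∉S)))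

-- Counting filtered lists by sums.

length-filter-tabulate : {A : Set} {P : A → Set} (P? : Decidable P) (f : Fin n → A) →
  length (filter P? (List.tabulate f)) ≡ ∑[ i < n ] 𝟙 (does (P? (f i)))
length-filter-tabulate {zero}  P? f = refl
length-filter-tabulate {suc n} P? f with ih ← length-filter-tabulate P? (f ∘ suc) | does (P? (f zero))
... | true  = cong suc ih
... | false = ih

-- Turns the list-based `edgeCount` into a double sum; `allFin n` is the tabulation of `id`.
length-filter-cartesianProduct : {A B : Set} {P : A × B → Set} (P? : Decidable P) {m : ℕ}
  (f : Fin m → A) (g : Fin n → B) →
  length (filter P? (cartesianProduct (List.tabulate f) (List.tabulate g))) ≡
  ∑[ i < m ] ∑[ j < n ] 𝟙 (does (P? (f i , g j)))
length-filter-cartesianProduct P? {zero}  f g = refl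
length-filter-cartesianProduct {n} P? {suc m} f g = begin
  length (filter P? (row List.++ rest))             ≡⟨ cong length (filter-++ P? row rest) ⟩
  length (filter P? row List.++ filter P? rest)     ≡⟨ length-++ (filter P? row) ⟩
  length (filter P? row) + length (filter P? rest)  ≡⟨ cong₂ _+_ row≡ (length-filter-cartesianProduct P? (f ∘ suc) g) ⟩
  _                                                 ∎
  where
  open ≡-Reasoning
  row  = List.map (f zero ,_) (List.tabulate g)
  rest = cartesianProduct (List.tabulate (f ∘ suc)) (List.tabulate g)
  row≡ : length (filter P? row) ≡ ∑[ j < n ] 𝟙 (does (P? (f zero , g j)))
  row≡ = trans (cong (length ∘ filter P?) (map-tabulate g (f zero ,_)))
               (length-filter-tabulate P? (λ j → f zero , g j))

-- Follow the walk to the first step that leaves `P`. Used with membership in a vertex set, it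
-- yields an edge across the boundary of that set.
crossing : {A : Set} {R : A → A → Set} {P : A → Set} → Decidable P →
           ∀ {u v} → Star R u v → P u → ¬ P v → ∃₂ λ x y → R x y × P x × ¬ P y
crossing P? ε pu ¬pv = contradiction pu ¬pv
crossing P? (_◅_ {j = w} r rs) pu ¬pv with P? w
... | yes pw = crossing P? rs pw ¬pv
... | no ¬pw = _ , _ , r , pu , ¬pw

-- Weighted arc counts and the handshake identity.

module _ (G : Graph n) where

  -- The bilinear form of the adjacency matrix. On the indicators of `A` and `B` it counts ordered
  -- adjacent pairs from `A` to `B`, so an edge inside `A` counts twice in `arcs (χ A) (χ A)`.
  arcs : (f g : Fin n → ℕ) → ℕ
  arcs f g = ∑[ u < n ] ∑[ v < n ] (f u * g v * 𝟙 (adj G u v))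

  deg : Fin n → ℕ
  deg u = ∑[ v < n ] 𝟙 (adj G u v)

  arcs-congˡ : ∀ {f f′} g → (∀ u → f u ≡ f′ u) → arcs f g ≡ arcs f′ g
  arcs-congˡ g f≗f′ = sum-cong-≗ λ u → sum-cong-≗ λ v → cong (λ x → x * g v * _) (f≗f′ u)

  arcs-mono : ∀ {f f′ g g′} → (∀ u → f u ≤ f′ u) → (∀ v → g v ≤ g′ v) → arcs f g ≤ arcs f′ g′
  arcs-mono f≤f′ g≤g′ = ∑-mono λ u → ∑-mono λ v → *-monoˡ-≤ _ (*-mono-≤ (f≤f′ u) (g≤g′ v))

  arcs-sym : ∀ f g → arcs f g ≡ arcs g f
  arcs-sym f g = trans (∑-comm (λ u v → f u * g v * 𝟙 (adj G u v))) (sum-cong-≗ λ v → sum-cong-≗ λ u →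
    cong₂ _*_ (*-comm (f u) (g v)) (cong 𝟙 (adj-sym G u v)))

  arcs-+ˡ : ∀ f f′ g → arcs (λ u → f u + f′ u) g ≡ arcs f g + arcs f′ g
  arcs-+ˡ f f′ g = trans
    (sum-cong-≗ λ u → trans (sum-cong-≗ λ v → distrib (f u) (f′ u) (g v) _) (∑-distrib-+ {n} _ _))
    (∑-distrib-+ {n} _ _)
    where
    distrib : ∀ a b c d → (a + b) * c * d ≡ a * c * d + b * c * d
    distrib = solve-∀

  arcs-+ʳ : ∀ f g g′ → arcs f (λ u → g u + g′ u) ≡ arcs f g + arcs f g′
  arcs-+ʳ f g g′ = trans (arcs-sym f _) (trans (arcs-+ˡ g g′ f) (cong₂ _+_ (arcs-sym g f) (arcs-sym g′ f)))

  arcs-1ʳ : ∀ f → arcs f (λ _ → 1) ≡ ∑[ u < n ] (f u * deg u)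
  arcs-1ʳ f = sum-cong-≗ λ u → trans
    (sum-cong-≗ λ v → cong (_* 𝟙 (adj G u v)) (*-identityʳ (f u)))
    (sym (*-distribˡ-sum (f u) (λ v → 𝟙 (adj G u v))))

  -- Handshake identity: an ordered adjacent pair or its reverse, but not both, is listed in
  -- `edges`.
  arcs-11 : arcs (λ _ → 1) (λ _ → 1) ≡ edgeCount G + edgeCount G
  arcs-11 = begin
    ∑[ u < n ] ∑[ v < n ] (1 * 1 * 𝟙 (adj G u v))
      ≡⟨ sum-cong-≗ (λ u → trans (sum-cong-≗ (split u)) (∑-distrib-+ (listed u) (λ v → listed v u))) ⟩
    ∑[ u < n ] (sum (listed u) + ∑[ v < n ] listed v u)
      ≡⟨ ∑-distrib-+ (λ u → sum (listed u)) (λ u → ∑[ v < n ] listed v u) ⟩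
    ∑[ u < n ] sum (listed u) + ∑[ u < n ] ∑[ v < n ] listed v u
      ≡⟨ cong (∑[ u < n ] sum (listed u) +_) (∑-comm (λ u v → listed v u)) ⟩
    ∑[ u < n ] sum (listed u) + ∑[ u < n ] sum (listed u)
      ≡⟨ cong₂ _+_ count count ⟨
    edgeCount G + edgeCount G ∎
    where
    open ≡-Reasoning
    listed? : Decidable (λ ((u , v) : Fin n × Fin n) → u Fin.< v × T (adj G u v))
    listed? (u , v) = (u Fin.<? v) ×-dec T? (adj G u v)
    listed : Fin n → Fin n → ℕ
    listed u v = 𝟙 (does (listed? (u , v)))
    count : edgeCount G ≡ ∑[ u < n ] sum (listed u)
    count = length-filter-cartesianProduct listed? id id
    split : ∀ u v → 1 * 1 * 𝟙 (adj G u v) ≡ listed u v + listed v u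
    -- After the rewrite both indicators test the same adjacency, so trichotomy leaves exactly one
    -- of them off the diagonal; on the diagonal irreflexivity makes everything zero.
    split u v rewrite adj-sym G v u with Finₚ.<-cmp u v
    ... | tri< u<v _ v≮u rewrite dec-true (u Fin.<? v) u<v | dec-false (v Fin.<? u) v≮u = refl
    ... | tri> u≮v _ v<u rewrite dec-false (u Fin.<? v) u≮v | dec-true (v Fin.<? u) v<u = +-identityʳ _
    ... | tri≈ u≮u refl _ rewrite dec-false (u Fin.<? u) u≮u | adj-irr G u = refl

  -- Neighbourhoods, minimum degree and the degree bound.

  neighbours : Fin n → Subset n
  neighbours u = tabulate (adj G u)

  ∈-neighbours : ∀ {u v} → Adj G u v → v ∈ neighbours u
  ∈-neighbours {u} {v} uv = lookup⇒[]= v _ (trans (lookup∘tabulate (adj G u) v) (Equivalence.to T-≡ uv))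

  neighbours-Adj : ∀ {u v} → v ∈ neighbours u → Adj G u v
  neighbours-Adj {u} {v} v∈ =
    Equivalence.from T-≡ (trans (sym (lookup∘tabulate (adj G u) v)) ([]=⇒lookup v∈))

  Adj-irrefl : ∀ {u} → ¬ Adj G u u
  Adj-irrefl {u} = subst T (adj-irr G u)

  ∣neighbours∣≡deg : ∀ u → ∣ neighbours u ∣ ≡ deg u
  ∣neighbours∣≡deg u =
    trans (∣∣≡∑χ (neighbours u)) (sum-cong-≗ λ v → cong 𝟙 (lookup∘tabulate (adj G u) v))

  -- Deleting the neighbours of a vertex of small degree would isolate it.
  connected⇒k≤deg : Connected[ G ] k → ∀ u → k ≤ deg u
  connected⇒k≤deg {k} (k<n , conn) u = subst (k ≤_) (∣neighbours∣≡deg u) (≮⇒≥ small)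
    where
    N = neighbours u
    u∉N : u ∉ N
    u∉N = Adj-irrefl ∘ neighbours-Adj
    small : ¬ (∣ N ∣ < k)
    -- The closed neighbourhood has at most `k` vertices and `k < n`, so some `v` lies outside it. A
    -- walk from `u` to `v` avoiding `N` is then impossible: the empty one forces `v` to be `u`, and
    -- any first step enters `N`.
    small N<k with ∣∣<⇒∃∈∉ (N ∪ ⁅ u ⁆) ⊤
                     (subst₂ _<_ (sym (∣∪⁅⁆∣ u∉N)) (sym (∣⊤∣≡n n)) (≤-<-trans N<k k<n))
    ... | v , _ , v∉ with conn N N<k u∉N (v∉ ∘ x∈p∪q⁺ ∘ inj₁)
    ...   | ε                 = v∉ (x∈p∪q⁺ (inj₂ (x∈⁅x⁆ u)))
    ...   | (_ , w∉N , uw) ◅ _ = w∉N (∈-neighbours uw)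

  ∣S∣*k≤arcs : Connected[ G ] k → ∀ S → ∣ S ∣ * k ≤ arcs (χ S) (λ _ → 1)
  ∣S∣*k≤arcs {k} conn S = begin
    ∣ S ∣ * k                     ≡⟨ cong (_* k) (∣∣≡∑χ S) ⟩
    sum (χ S) * k                 ≡⟨ *-distribʳ-sum k (χ S) ⟩
    ∑[ u < n ] (χ S u * k)        ≤⟨ ∑-mono (λ u → *-monoʳ-≤ (χ S u) (connected⇒k≤deg conn u)) ⟩
    ∑[ u < n ] (χ S u * deg u)    ≡⟨ arcs-1ʳ (χ S) ⟨
    arcs (χ S) (λ _ → 1)          ∎
    where open ≤-Reasoning

  ≤2e⇒⌈/2⌉≤e : ∀ {m} → m ≤ edgeCount G + edgeCount G → ⌈ m /2⌉ ≤ edgeCount G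
  ≤2e⇒⌈/2⌉≤e m≤2e = ≤-trans (⌈n/2⌉-mono m≤2e) (≤-reflexive (sym (n≡⌈n+n/2⌉ _)))

  -- Summing the degree bound over all vertices counts every edge twice.
  ⌈nk/2⌉≤e : Connected[ G ] k → ⌈ n * k /2⌉ ≤ edgeCount G
  ⌈nk/2⌉≤e {k} conn = ≤2e⇒⌈/2⌉≤e (begin
    n * k                            ≡⟨ cong (_* k) (∣⊤∣≡n n) ⟨
    ∣ ⊤ {n} ∣ * k                    ≤⟨ ∣S∣*k≤arcs conn ⊤ ⟩
    arcs (χ ⊤) (λ _ → 1)             ≡⟨ arcs-congˡ _ (λ u → χ-∈ (∈⊤ {x = u})) ⟩
    arcs (λ _ → 1) (λ _ → 1)         ≡⟨ arcs-11 ⟩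
    edgeCount G + edgeCount G        ∎)
    where open ≤-Reasoning

  -- Edges of the connected graph left after a deletion.

  1≤arcs : ∀ {A x y} → x ∈ A → Adj G x y → 1 ≤ arcs (χ A) (χ ⁅ y ⁆)
  1≤arcs {A} {x} {y} x∈A xy = begin
    1
      ≡⟨ cong₂ _*_ (cong₂ _*_ (χ-∈ x∈A) (χ-∈ (x∈⁅x⁆ y))) (cong 𝟙 (Equivalence.to T-≡ xy)) ⟨
    χ A x * χ ⁅ y ⁆ y * 𝟙 (adj G x y)
      ≤⟨ term≤∑ (λ v → χ A x * χ ⁅ y ⁆ v * 𝟙 (adj G x v)) y ⟩
    ∑[ v < n ] (χ A x * χ ⁅ y ⁆ v * 𝟙 (adj G x v))
      ≤⟨ term≤∑ _ x ⟩
    arcs (χ A) (χ ⁅ y ⁆) ∎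
    where open ≤-Reasoning

  -- Expand bilinearly over `A` and the new vertex: the two mixed terms are equal by symmetry, and
  -- each is at least one because of the edge `xy`.
  arcs-∪-⁅⁆ : ∀ {A x y} → x ∈ A → y ∉ A → Adj G x y →
              2 + arcs (χ A) (χ A) ≤ arcs (χ (A ∪ ⁅ y ⁆)) (χ (A ∪ ⁅ y ⁆))
  arcs-∪-⁅⁆ {A} {x} {y} x∈A y∉A xy = begin
    2 + arcs a a                                     ≡⟨ +-comm 2 _ ⟩
    arcs a a + (1 + 1)
      ≤⟨ +-monoʳ-≤ (arcs a a) (+-mono-≤ (1≤arcs x∈A xy) (1≤arcs x∈A xy)) ⟩
    arcs a a + (arcs a d + arcs a d)                 ≡⟨ cong (λ z → arcs a a + (arcs a d + z)) (arcs-sym a d) ⟩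
    arcs a a + (arcs a d + arcs d a)                 ≡⟨ +-assoc (arcs a a) _ _ ⟨
    arcs a a + arcs a d + arcs d a                   ≤⟨ +-monoʳ-≤ (arcs a a + arcs a d) (m≤m+n _ (arcs d d)) ⟩
    arcs a a + arcs a d + (arcs d a + arcs d d)      ≡⟨ cong₂ _+_ (arcs-+ʳ a a d) (arcs-+ʳ d a d) ⟨
    arcs a a+d + arcs d a+d                          ≡⟨ arcs-+ˡ a d a+d ⟨
    arcs a+d a+d                                     ≤⟨ arcs-mono a+d≤ a+d≤ ⟩
    arcs (χ (A ∪ ⁅ y ⁆)) (χ (A ∪ ⁅ y ⁆))             ∎
    where
    open ≤-Reasoning
    a d a+d : Fin n → ℕ
    a     = χ A
    d     = χ ⁅ y ⁆
    a+d v = a v + d v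
    a+d≤ : ∀ v → a+d v ≤ χ (A ∪ ⁅ y ⁆) v
    a+d≤ v = ≤-reflexive (sym (χ-∪-⁅⁆ y∉A v))

  -- Each vertex added to A brings at least one edge, that is, two arcs.
  grow : ∀ {S} → ConnectedAfterDeleting G S → ∀ m → m < ∣ ∁ S ∣ →
         ∃ λ A → A ⊆ ∁ S × ∣ A ∣ ≡ suc m × m + m ≤ arcs (χ A) (χ A)
  grow {S} conn zero 0<∣∁S∣
    with w , w∈∁S , _ ← ∣∣<⇒∃∈∉ ⊥ (∁ S) (subst (_< ∣ ∁ S ∣) (sym (∣⊥∣≡0 n)) 0<∣∁S∣)
    = ⁅ w ⁆ , (λ x∈ → subst (_∈ ∁ S) (sym (x∈⁅y⁆⇒x≡y w x∈)) w∈∁S) , ∣⁅x⁆∣≡1 w , z≤n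
  grow {S} conn (suc m) 1+m<∣∁S∣
    with A , A⊆ , ∣A∣ , m+m≤ ← grow conn m (<⇒≤ 1+m<∣∁S∣)
    -- `A` is nonempty and smaller than `∁ S`, so a walk avoiding `S` from a vertex of `A` to one of
    -- `∁ S` outside `A` has a step that leaves `A`. Its endpoint `y` avoids `S`, which keeps the
    -- enlarged set inside `∁ S`.
    with u , u∈A , _ ← ∣∣<⇒∃∈∉ ⊥ A (subst₂ _<_ (sym (∣⊥∣≡0 n)) (sym ∣A∣) (s≤s z≤n))
    with w , w∈∁S , w∉A ← ∣∣<⇒∃∈∉ A (∁ S) (subst (_< ∣ ∁ S ∣) (sym ∣A∣) 1+m<∣∁S∣)
    with x , y , (_ , y∉S , xy) , x∈A , y∉A ←
         crossing (_∈? A) (conn (x∈∁p⇒x∉p (A⊆ u∈A)) (x∈∁p⇒x∉p w∈∁S)) u∈A w∉A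
    = A ∪ ⁅ y ⁆
    , (λ z∈ → [ A⊆ , (λ z∈⁅y⁆ → subst (_∈ ∁ S) (sym (x∈⁅y⁆⇒x≡y y z∈⁅y⁆)) (x∉p⇒x∈∁p y∉S)) ]′
                (x∈p∪q⁻ A ⁅ y ⁆ z∈))
    , trans (∣∪⁅⁆∣ y∉A) (cong suc ∣A∣)
    , (begin
        suc m + suc m            ≡⟨ cong suc (+-suc m m) ⟩
        2 + (m + m)              ≤⟨ +-monoʳ-≤ 2 m+m≤ ⟩
        2 + arcs (χ A) (χ A)     ≤⟨ arcs-∪-⁅⁆ x∈A y∉A xy ⟩
        arcs (χ (A ∪ ⁅ y ⁆)) (χ (A ∪ ⁅ y ⁆)) ∎)
    where open ≤-Reasoning

  -- The arcs inside the grown set already suffice. With `m` one less than the order of `∁ S`, this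
  -- is the spanning tree bound.
  2m≤arcs-∁ : ∀ {S m} → ConnectedAfterDeleting G S → m < ∣ ∁ S ∣ → m + m ≤ arcs (χ (∁ S)) (χ (∁ S))
  2m≤arcs-∁ {S} {m} conn m<∣∁S∣ with A , A⊆ , _ , m+m≤ ← grow conn m m<∣∁S∣ =
    ≤-trans m+m≤ (arcs-mono χA≤ χA≤)
    where
    χA≤ : ∀ v → χ A v ≤ χ (∁ S) v
    χA≤ v with v ∈? A
    ... | yes v∈A = ≤-reflexive (trans (χ-∈ v∈A) (sym (χ-∈ (A⊆ v∈A))))
    ... | no  v∉A = ≤-trans (≤-reflexive (χ-∉ v∉A)) z≤n

  -- The edge bound from an independent set.

  arcs-independent : ∀ {S} → Independent G S → arcs (χ S) (χ S) ≡ 0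
  arcs-independent {S} ind = ∑-0 λ u → ∑-0 λ v → term u v
    where
    term : ∀ u v → χ S u * χ S v * 𝟙 (adj G u v) ≡ 0
    term u v with u ∈? S | v ∈? S | adj G u v in eq
    ... | _       | _       | false = *-zeroʳ (χ S u * χ S v)
    ... | no  u∉S | _       | true  = cong (λ x → x * χ S v * 1) (χ-∉ u∉S)
    ... | yes _   | no  v∉S | true  =
      trans (cong (λ x → χ S u * x * 1) (χ-∉ v∉S)) (cong (_* 1) (*-zeroʳ (χ S u)))
    ... | yes u∈S | yes v∈S | true  = contradiction (Equivalence.from T-≡ eq) (ind u∈S v∈S)

  -- Twice the edge count splits into arcs from `S` to everything, arcs from `S` to `∁ S`, and arcs
  -- within `∁ S`. The first two are each at least `∣ S ∣ * k` by the degree bound, since no arc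
  -- stays inside `S`. Deleting `S` leaves a connected graph because `∣ S ∣ < k`, so the third is at
  -- least `m + m`.
  independent-bound : ∀ {S m} → Connected[ G ] k → Independent G S → ∣ S ∣ < k →
                      m < ∣ ∁ S ∣ → ∣ S ∣ * k + m ≤ edgeCount G
  independent-bound {k} {S} {m} conn ind ∣S∣<k m<∣∁S∣ =
    subst (_≤ edgeCount G) (sym (n≡⌈n+n/2⌉ _)) (≤2e⇒⌈/2⌉≤e (begin
      (∣ S ∣ * k + m) + (∣ S ∣ * k + m)       ≡⟨ regroup (∣ S ∣ * k) m ⟩
      ∣ S ∣ * k + (∣ S ∣ * k + (m + m))
        ≤⟨ +-mono-≤ S*k≤ (+-mono-≤ S*k≤sw (2m≤arcs-∁ (proj₂ conn S ∣S∣<k) m<∣∁S∣)) ⟩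
      arcs s 1s + (arcs s w + arcs w w)       ≡⟨ cong (arcs s 1s +_) (arcs-+ˡ s w w) ⟨
      arcs s 1s + arcs (λ v → s v + w v) w    ≡⟨ cong (arcs s 1s +_) (arcs-congˡ w (χ-∁ S)) ⟨
      arcs s 1s + arcs 1s w                   ≡⟨ cong (arcs s 1s +_) (arcs-sym 1s w) ⟩
      arcs s 1s + arcs w 1s                   ≡⟨ arcs-+ˡ s w 1s ⟨
      arcs (λ v → s v + w v) 1s               ≡⟨ arcs-congˡ 1s (χ-∁ S) ⟨
      arcs 1s 1s                              ≡⟨ arcs-11 ⟩
      edgeCount G + edgeCount G               ∎))
    where
    open ≤-Reasoning
    s w 1s : Fin n → ℕ
    s    = χ S
    w    = χ (∁ S)
    1s _ = 1
    regroup : ∀ a b → (a + b) + (a + b) ≡ a + (a + (b + b))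
    regroup = solve-∀
    S*k≤ : ∣ S ∣ * k ≤ arcs s 1s
    S*k≤ = ∣S∣*k≤arcs conn S
    S*k≤sw : ∣ S ∣ * k ≤ arcs s w
    S*k≤sw = begin
      ∣ S ∣ * k                   ≤⟨ S*k≤ ⟩
      arcs s 1s                   ≡⟨ arcs-sym s 1s ⟩
      arcs 1s s                   ≡⟨ arcs-congˡ s (χ-∁ S) ⟩
      arcs (λ v → s v + w v) s    ≡⟨ arcs-+ˡ s w s ⟩
      arcs s s + arcs w s         ≡⟨ cong₂ _+_ (arcs-independent ind) (arcs-sym w s) ⟩
      arcs s w                    ∎

-- Deciding membership in the class by exhaustive search.

allSubset? : {P : Subset n → Set} → Decidable P → Dec (∀ S → P S)
allSubset? {zero}  P? = map′ (λ p → λ { [] → p }) (λ f → f []) (P? [])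
allSubset? {suc n} P? = map′
  (λ (p , q) → λ { (inside ∷ S) → p S ; (outside ∷ S) → q S })
  (λ f → f ∘ (inside ∷_) , f ∘ (outside ∷_))
  (allSubset? (P? ∘ (inside ∷_)) ×-dec allSubset? (P? ∘ (outside ∷_)))

module _ (G : Graph n) where

  -- Bounding the length of a walk by `d` makes its existence decidable by recursion, which `Star`
  -- does not offer directly.
  WalkAvoiding : Subset n → ℕ → Fin n → Fin n → Set
  WalkAvoiding S zero    u v = u ≡ v
  WalkAvoiding S (suc d) u v = u ≡ v ⊎ ∃ λ w → AdjAvoiding G S u w × WalkAvoiding S d w v

  walkAvoiding? : ∀ S d u v → Dec (WalkAvoiding S d u v)
  walkAvoiding? S zero    u v = u Finₚ.≟ v
  walkAvoiding? S (suc d) u v = (u Finₚ.≟ v) ⊎-dec any? λ w →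
    (¬? (u ∈? S) ×-dec ¬? (w ∈? S) ×-dec T? (adj G u w)) ×-dec walkAvoiding? S d w v

  walk⇒Star : ∀ {S} d {u v} → WalkAvoiding S d u v → Star (AdjAvoiding G S) u v
  walk⇒Star zero    refl                 = ε
  walk⇒Star (suc d) (inj₁ refl)          = ε
  walk⇒Star (suc d) (inj₂ (w , uw , wv)) = uw ◅ walk⇒Star d wv

  independent? : Decidable (Independent G)
  independent? S = map′ (λ h {u} {v} → h u v) (λ h u v → h {u} {v})
    (all? λ u → all? λ v → (u ∈? S) →-dec (v ∈? S) →-dec ¬? (T? (adj G u v)))

  SmallDiameterAfterDeleting : ℕ → ℕ → Set
  SmallDiameterAfterDeleting k d =
    ∀ S → ∣ S ∣ < k → ∀ u → u ∉ S → ∀ v → v ∉ S → WalkAvoiding S d u v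

  smallDiameterAfterDeleting? : ∀ k d → Dec (SmallDiameterAfterDeleting k d)
  smallDiameterAfterDeleting? k d = allSubset? λ S → (∣ S ∣ <? k) →-dec
    all? λ u → ¬? (u ∈? S) →-dec all? λ v → ¬? (v ∈? S) →-dec walkAvoiding? S d u v

  inClass : ∀ α k →
    {True (k <? n)} →
    -- Length three is needed: deleting the three pairwise nonadjacent vertices of `3K₁∨P₄` leaves a
    -- path on four vertices, of diameter three.
    {True (smallDiameterAfterDeleting? k 3)} →
    {True (anySubset? λ S → independent? S ×-dec (∣ S ∣ ≟ α))} →
    {True (allSubset? λ S → independent? S →-dec (∣ S ∣ ≤? α))} →
    InClass n α k G
  inClass α k {k<n} {walks} {attained} {maximal} =
    ( toWitness k<n
    , λ S ∣S∣<k {u} {v} u∉S v∉S → walk⇒Star 3 (toWitness walks S ∣S∣<k u u∉S v v∉S))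
    , (toWitness attained , toWitness maximal)

-- Explicit extremal graphs.

graph : (a : Fin n → Fin n → Bool) →
  {True (all? λ u → all? λ v → a u v Boolₚ.≟ a v u)} →
  {True (all? λ u → a u u Boolₚ.≟ false)} → Graph n
graph a {symmetric} {irreflexive} = record
  { adj     = a
  ; adj-sym = toWitness symmetric
  ; adj-irr = toWitness irreflexive
  }

-- The graphs needed are dense or have simple complements, so they are given by their non-edges.
-- Testing both orientations makes the relation symmetric.
coadj : List (ℕ × ℕ) → Fin n → Fin n → Bool
coadj nonEdges u v = not (toℕ u ≡ᵇ toℕ v) ∧ not (any matches nonEdges)
  where
  matches : ℕ × ℕ → Bool
  matches (i , j) = (toℕ u ≡ᵇ i) ∧ (toℕ v ≡ᵇ j) ∨ (toℕ u ≡ᵇ j) ∧ (toℕ v ≡ᵇ i)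

-- Vertex 4 is the hub; the rim is the four-cycle 0, 2, 1, 3.
wheel : Graph 5
wheel = graph (coadj ((0 , 1) ∷ (2 , 3) ∷ []))

-- The complement of a hexagon.
prism : Graph 6
prism = graph (coadj ((0 , 1) ∷ (1 , 2) ∷ (2 , 3) ∷ (3 , 4) ∷ (4 , 5) ∷ (5 , 0) ∷ []))

octahedron : Graph 6
octahedron = graph (coadj ((0 , 1) ∷ (2 , 3) ∷ (4 , 5) ∷ []))

K₃₃ : Graph 6
K₃₃ = graph (coadj ((0 , 1) ∷ (1 , 2) ∷ (2 , 0) ∷ (3 , 4) ∷ (4 , 5) ∷ (5 , 3) ∷ []))

-- A path on four vertices is self-complementary.
3K₁∨P₄ : Graph 7
3K₁∨P₄ = graph (coadj ((0 , 1) ∷ (1 , 2) ∷ (2 , 0) ∷ (3 , 4) ∷ (4 , 5) ∷ (5 , 6) ∷ []))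

-- Exact values of f.

-- For this triple and the next three the value is `⌈ n * k /2⌉`. The graphs on six vertices are
-- `k`-regular; in `wheel` only the hub exceeds degree three, by one, as the odd product 15
-- requires.
f523 : f⟨ 5 , 2 , 3 ⟩≡ 8
f523 = (wheel , inClass wheel 2 3 , refl) , λ G (conn , _) → ⌈nk/2⌉≤e G conn

f623 : f⟨ 6 , 2 , 3 ⟩≡ 9
f623 = (prism , inClass prism 2 3 , refl) , λ G (conn , _) → ⌈nk/2⌉≤e G conn

f624 : f⟨ 6 , 2 , 4 ⟩≡ 12
f624 = (octahedron , inClass octahedron 2 4 , refl) , λ G (conn , _) → ⌈nk/2⌉≤e G conn

f633 : f⟨ 6 , 3 , 3 ⟩≡ 9
f633 = (K₃₃ , inClass K₃₃ 3 3 , refl) , λ G (conn , _) → ⌈nk/2⌉≤e G conn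

f734 : f⟨ 7 , 3 , 4 ⟩≡ 15
f734 = (3K₁∨P₄ , inClass 3K₁∨P₄ 3 4 , refl) , bound
  where
  bound : ∀ G → InClass 7 3 4 G → 15 ≤ edgeCount G
  bound G (conn , (S , ind , ∣S∣≡3) , _) =
    -- The summand 3 is the number of edges of a spanning tree on the four vertices outside `S`; at
    -- `s = 3` the left side computes to 15.
    subst (λ s → s * 4 + 3 ≤ edgeCount G) ∣S∣≡3
      (independent-bound G conn ind (≤-reflexive (cong suc ∣S∣≡3))
        (≤-reflexive (sym (trans (∣∁p∣≡n∸∣p∣ S) (cong (7 ∸_) ∣S∣≡3)))))

-- Admissible triples of small order and the minimal counterexample.

Admissible : ℕ → ℕ → ℕ → Set
Admissible n α k = 2 * α ≤ n × α + k ≤ n × 2 ≤ α × 3 ≤ k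

admissible? : ∀ n α k → Dec (Admissible n α k)
admissible? n α k = (2 * α ≤? n) ×-dec (α + k ≤? n) ×-dec (2 ≤? α) ×-dec (3 ≤? k)

smallTriples : List (ℕ × ℕ × ℕ)
smallTriples = (5 , 2 , 3) ∷ (6 , 2 , 3) ∷ (6 , 2 , 4) ∷ (6 , 3 , 3) ∷ []

-- A finite search: `α + k ≤ n` bounds `α` and `k` by the same 7 as `n`.
admissible⇒small : ∀ {n} → n < 7 → ∀ {α} → α < 7 → ∀ {k} → k < 7 →
                   Admissible n α k → (n , α , k) ∈ₗ smallTriples
admissible⇒small = from-yes (allUpTo? (λ n → allUpTo? (λ α → allUpTo? (λ k →
  admissible? n α k →-dec ((n , α , k) ∈ₗ? smallTriples)) 7) 7) 7)
  where
  open import Data.List.Membership.DecPropositional (×-≡-dec _≟_ (×-≡-dec _≟_ _≟_))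
    renaming (_∈?_ to _∈ₗ?_)

¬small : ∀ {n α k} → (n , α , k) ∈ₗ smallTriples → ¬ Counterexample n α k
¬small (here refl)                         c = Counterexample.fails c f523
¬small (there (here refl))                 c = Counterexample.fails c f623
¬small (there (there (here refl)))         c = Counterexample.fails c f624
¬small (there (there (there (here refl)))) c = Counterexample.fails c f633

counterexample⇒7≤n : ∀ n α k → Counterexample n α k → 7 ≤ n
counterexample⇒7≤n n α k c = ≮⇒≥ λ n<7 →
  ¬small (admissible⇒small n<7 (≤-<-trans (m+n≤o⇒m≤o α α+k≤n) n<7)
                               (≤-<-trans (m+n≤o⇒n≤o α α+k≤n) n<7)
                               (2α≤n , α+k≤n , 2≤α , 3≤k)) c
  where open Counterexample c

counterexample734 : Counterexample 7 3 4
counterexample734 = record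
  { 2α≤n  = from-yes (6 ≤? 7)
  ; α+k≤n = ≤-refl
  ; 2≤α   = from-yes (2 ≤? 3)
  ; 3≤k   = from-yes (3 ≤? 4)
  -- Since 7 ≤ 4 · 3, the formula computes to half of 28, that is 14. The lower bound 15 is by
  -- definition `14 < edgeCount G`, which excludes a graph with 14 edges.
  ; fails = λ ((G , G∈ , e≡14) , _) → <⇒≢ (proj₂ f734 G G∈) (sym e≡14)
  }

proposition4p1 : (∃₂ λ α k → Counterexample 7 α k)
    × (∀ n α k → Counterexample n α k → 7 ≤ n)
    × (f⟨ 7 , 3 , 4 ⟩≡ 15)
    × (formula 7 3 4 ≡ 14)
proposition4p1 = (3 , 4 , counterexample734) , counterexample⇒7≤n , f734 , refl
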